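{- For all positive integers $n,k$ and every $\boldsymbol\rho=(\rho_1,\dots,\rho_k)$ of integers with $1\le\rho_\ell\le n\le k$ for all $\ell\in[k]$ and $\sum_{\ell\in[k]}\rho_\ell=n^2$, there exists a $\boldsymbol\rho$-latin square of order $n$.
   Context: A $\boldsymbol\rho$-latin square of order $n$ is an $n\times n$ array in which every cell contains a symbol of $[k]$, each symbol occurs at most once in each row and at most once in each column, and each symbol $\ell$ occurs exactly $\rho_\ell$ times. -}

module Defs where

open import Data.Fin using (Fin; _≟_)
open import Data.List using (allFin; cartesianProduct; filter; length)
open import Data.Nat using (ℕ)
open import Data.Product using (_,_)
open import Data.Vec.Functional using (Vector)
open import Function.Definitions using (Injective)
open import Relation.Binary.PropositionalEquality using (_≡_)

-- Rows and columns are indexed by Fin n; the symbol set [k] is Fin k.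
Array : ℕ → ℕ → Set
Array n k = Fin n → Fin n → Fin k

occurrences : ∀ {n k} → Array n k → Fin k → ℕ
occurrences {n} L ℓ =
  length (filter (λ (i , j) → L i j ≟ ℓ)
                 (cartesianProduct (allFin n) (allFin n)))

-- A symbol occurs at most once in a line exactly when the line, read as a
-- function from positions to symbols, is injective.
record IsLatinSquare {n k : ℕ} (ρ : Vector ℕ k) (L : Array n k) : Set where
  field
    row-injective    : ∀ i → Injective _≡_ _≡_ (λ j → L i j)
    column-injective : ∀ j → Injective _≡_ _≡_ (λ i → L i j)
    occurs-ρ         : ∀ ℓ → occurrences L ℓ ≡ ρ ℓ

{-# OPTIONS --safe #-}
-- Enumerate the n² cells by sending position p to row p mod n and column
-- p + ⌊p/n⌋ mod n, so that the positions in [cn , cn + n) run through one broken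
-- diagonal.  Any n - 1 consecutive positions lie in distinct rows and distinct
-- columns, and so do the n positions of one diagonal.  Cut [0 , n²) into
-- intervals of lengths ρ ℓ, those of length n first: these are whole diagonals,
-- and the others are shorter than n, so giving the interval ℓ the symbol ℓ works.
module Submission where

open import Defs
open import Data.Nat using (ℕ; _≤_; _^_)
open import Data.Nat.Properties using (+-0-commutativeMonoid; +-commutativeSemigroup)
open import Algebra.Properties.CommutativeMonoid.Sum +-0-commutativeMonoid using (sum)
open import Data.Product using (∃-syntax)
open import Data.Vec.Functional using (Vector)
open import Relation.Binary.PropositionalEquality using (_≡_)

open import Algebra.Properties.CommutativeSemigroup +-commutativeSemigroup using (xy∙z≈xz∙y)
open import Data.Empty using (⊥-elim)
open import Data.Fin as Fin using (Fin; toℕ; zero; suc)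
open import Data.Fin.Properties using (toℕ<n; toℕ-fromℕ<; toℕ-injective; toℕ≤n)
open import Data.List using (List; allFin; applyUpTo; cartesianProduct; filter; length; map)
open import Data.List.Membership.Propositional using (_∈_)
open import Data.List.Membership.Propositional.Properties
  using (∈-allFin; ∈-applyUpTo⁺; ∈-applyUpTo⁻; ∈-cartesianProduct⁺; ∈-filter⁺; ∈-filter⁻; ∈-map⁺; ∈-map⁻)
open import Data.List.Membership.Propositional.Properties.WithK using (unique∧set⇒bag)
open import Data.List.Properties using (length-applyUpTo; length-map)
open import Data.List.Relation.Binary.BagAndSetEquality using (∼bag⇒↭)
open import Data.List.Relation.Binary.Permutation.Propositional.Properties using (↭-length)
open import Data.List.Relation.Unary.Unique.Propositional using (Unique)
import Data.List.Relation.Unary.Unique.Propositional.Properties as Unique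
open import Data.Nat using (suc; _+_; _*_; _∸_; _<_; _≤?_; _≟_; NonZero; >-nonZero; z≤n)
open import Data.Nat.DivMod
open import Data.Nat.Divisibility using (_∣_; divides; _∣0; ∣m∣n⇒∣m+n; ∣-reflexive)
open import Data.Nat.Properties hiding (_≟_; _≤?_; +-0-commutativeMonoid; +-commutativeSemigroup)
open import Data.Product using (_×_; _,_; proj₁; proj₂; uncurry)
open import Data.Sum using (inj₁; inj₂)
open import Function using (_∘_)
open import Function.Bundles using (_⇔_; mk⇔)
open import Relation.Binary.Definitions using (tri<; tri≈; tri>)
open import Relation.Binary.PropositionalEquality
  using (_≢_; refl; sym; trans; cong; cong₂; subst; module ≡-Reasoning)
open import Relation.Nullary using (yes; no)

-- Duplicate-freeness turns equal sets into equal bags, hence into permuted lists. This serves to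
-- count the cells that carry one symbol.
length-cong-set : ∀ {A : Set} {xs ys : List A} → Unique xs → Unique ys →
                  (∀ {x} → x ∈ xs ⇔ x ∈ ys) → length xs ≡ length ys
length-cong-set xs! ys! xs≈ys = ↭-length (∼bag⇒↭ (unique∧set⇒bag xs! ys! xs≈ys))

-- Cutting an initial segment of the naturals into intervals

record Layout (n : ℕ) {k : ℕ} (ρ : Vector ℕ k) : Set where
  field
    start : Vector ℕ k

  Block : Fin k → ℕ → Set
  Block ℓ p = start ℓ ≤ p × p < start ℓ + ρ ℓ

  field
    bounded  : ∀ ℓ → start ℓ + ρ ℓ ≤ sum ρ
    cover    : ∀ {p} → p < sum ρ → ∃[ ℓ ] Block ℓ p
    disjoint : ∀ {ℓ ℓ′ p} → Block ℓ p → Block ℓ′ p → ℓ ≡ ℓ′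
    -- Blocks of length `n` thereby coincide with whole broken diagonals; shorter blocks may start
    -- anywhere.
    aligned  : ∀ ℓ → ρ ℓ ≡ n → n ∣ start ℓ

module _ {n k : ℕ} (ρ : Vector ℕ (suc k)) (T : Layout n (ρ ∘ suc)) where
  open Layout T

  private
    r = ρ zero

  -- A full block goes in front: the other blocks move by exactly `n`, so divisibility of their
  -- starts by `n` survives.
  prependFull : r ≡ n → Layout n ρ
  prependFull r≡n = record
    { start    = start′
    ; bounded  = bounded′
    ; cover    = cover′
    ; disjoint = disjoint′
    ; aligned  = aligned′
    }
    where
    start′ : Vector ℕ (suc k)
    start′ zero    = 0
    start′ (suc ℓ) = r + start ℓ

    Block′ : Fin (suc k) → ℕ → Set
    Block′ ℓ p = start′ ℓ ≤ p × p < start′ ℓ + ρ ℓ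

    shift : ∀ ℓ {q} → Block ℓ q → Block′ (suc ℓ) (r + q)
    shift ℓ {q} (l , u) = +-monoʳ-≤ r l ,
      subst (r + q <_) (sym (+-assoc r (start ℓ) _)) (+-monoʳ-< r u)

    unshift : ∀ ℓ {q} → Block′ (suc ℓ) (r + q) → Block ℓ q
    unshift ℓ {q} (l , u) = +-cancelˡ-≤ r _ _ l ,
      +-cancelˡ-< r _ _ (subst (r + q <_) (+-assoc r (start ℓ) _) u)

    bounded′ : ∀ ℓ → start′ ℓ + ρ ℓ ≤ sum ρ
    bounded′ zero    = m≤m+n r _
    bounded′ (suc ℓ) = subst (_≤ sum ρ) (sym (+-assoc r (start ℓ) _))
      (+-monoʳ-≤ r (bounded ℓ))

    cover′ : ∀ {p} → p < sum ρ → ∃[ ℓ ] Block′ ℓ p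
    cover′ {p} p< with r ≤? p
    ... | no  r≰p = zero , z≤n , ≰⇒> r≰p
    ... | yes r≤p with q , refl ← m≤n⇒∃[o]m+o≡n r≤p
                  with ℓ , b ← cover (+-cancelˡ-< r _ _ p<) = suc ℓ , shift ℓ b

    disjoint′ : ∀ {ℓ ℓ′ p} → Block′ ℓ p → Block′ ℓ′ p → ℓ ≡ ℓ′
    disjoint′ {zero}  {zero}   _       _       = refl
    disjoint′ {zero}  {suc ℓ′} (_ , u) (l , _) = ⊥-elim (m+n≮m r _ (≤-<-trans l u))
    disjoint′ {suc ℓ} {zero}   (l , _) (_ , u) = ⊥-elim (m+n≮m r _ (≤-<-trans l u))
    disjoint′ {suc ℓ} {suc ℓ′} b       b′
      with q , refl ← m≤n⇒∃[o]m+o≡n (≤-trans (m≤m+n r _) (proj₁ b))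
      = cong suc (disjoint (unshift ℓ b) (unshift ℓ′ b′))

    aligned′ : ∀ ℓ → ρ ℓ ≡ n → n ∣ start′ ℓ
    aligned′ zero    _ = n ∣0
    aligned′ (suc ℓ) e = ∣m∣n⇒∣m+n (∣-reflexive (sym r≡n)) (aligned ℓ e)

  -- A short block goes behind all others: nothing moves, and the new block is under no alignment
  -- condition.
  appendShort : r ≢ n → Layout n ρ
  appendShort r≢n = record
    { start    = start′
    ; bounded  = bounded′
    ; cover    = cover′
    ; disjoint = disjoint′
    ; aligned  = aligned′
    }
    where
    S = sum (ρ ∘ suc)

    start′ : Vector ℕ (suc k)
    start′ zero    = S
    start′ (suc ℓ) = start ℓ

    Block′ : Fin (suc k) → ℕ → Set
    Block′ ℓ p = start′ ℓ ≤ p × p < start′ ℓ + ρ ℓ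

    bounded′ : ∀ ℓ → start′ ℓ + ρ ℓ ≤ sum ρ
    bounded′ zero    = ≤-reflexive (+-comm S r)
    bounded′ (suc ℓ) = ≤-trans (bounded ℓ) (m≤n+m S r)

    cover′ : ∀ {p} → p < sum ρ → ∃[ ℓ ] Block′ ℓ p
    cover′ {p} p< with S ≤? p
    ... | yes S≤p = zero , S≤p , subst (p <_) (+-comm r S) p<
    ... | no  S≰p with ℓ , b ← cover (≰⇒> S≰p) = suc ℓ , b

    disjoint′ : ∀ {ℓ ℓ′ p} → Block′ ℓ p → Block′ ℓ′ p → ℓ ≡ ℓ′
    disjoint′ {zero}  {zero}   _       _       = refl
    disjoint′ {zero}  {suc ℓ′} (l , _) (_ , u) = ⊥-elim (<⇒≱ (<-≤-trans u (bounded ℓ′)) l)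
    disjoint′ {suc ℓ} {zero}   (_ , u) (l , _) = ⊥-elim (<⇒≱ (<-≤-trans u (bounded ℓ)) l)
    disjoint′ {suc ℓ} {suc ℓ′} b       b′      = cong suc (disjoint b b′)

    aligned′ : ∀ ℓ → ρ ℓ ≡ n → n ∣ start′ ℓ
    aligned′ zero    e = ⊥-elim (r≢n e)
    aligned′ (suc ℓ) e = aligned ℓ e

-- Choosing the end of the line at which each symbol is added puts the full blocks first without
-- sorting `ρ`.
layout : ∀ n {k} (ρ : Vector ℕ k) → Layout n ρ
layout n {0} ρ = record
  { start = λ () ; bounded = λ () ; cover = λ () ; disjoint = λ { {()} } ; aligned = λ () }
layout n {suc k} ρ with ρ zero ≟ n
... | yes full = prependFull ρ (layout n (ρ ∘ suc)) full
... | no short = appendShort ρ (layout n (ρ ∘ suc)) short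

-- Residues modulo `n`

module _ {n : ℕ} .{{_ : NonZero n}} where

  [m%n+o]%n≡[m+o]%n : ∀ a b → (a % n + b) % n ≡ (a + b) % n
  [m%n+o]%n≡[m+o]%n a b = begin
    (a % n + b) % n           ≡⟨ %-distribˡ-+ (a % n) b n ⟩
    (a % n % n + b % n) % n   ≡⟨ cong (λ x → (x + b % n) % n) (m%n%n≡m%n a n) ⟩
    (a % n + b % n) % n       ≡⟨ %-distribˡ-+ a b n ⟨
    (a + b) % n               ∎
    where open ≡-Reasoning

  -- With equal remainders, equal quotients give `x ≡ y`, while a larger quotient of `y` would put
  -- `y` at least `n` above `x`.
  %-≡-close : ∀ {x y} → x ≤ y → y < x + n → x % n ≡ y % n → x ≡ y
  %-≡-close {x} {y} x≤y y<x+n e with <-cmp (x / n) (y / n)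
  ... | tri≈ _ q _ = trans (m≡m%n+[m/n]*n x n)
      (trans (cong₂ (λ a b → a + b * n) e q) (sym (m≡m%n+[m/n]*n y n)))
  ... | tri> _ _ q = ⊥-elim (<⇒≱ q (/-monoˡ-≤ n x≤y))
  ... | tri< q _ _ = ⊥-elim (<⇒≱ y<x+n (begin
    x + n                         ≡⟨ cong (_+ n) (m≡m%n+[m/n]*n x n) ⟩
    x % n + x / n * n + n         ≡⟨ +-assoc (x % n) _ n ⟩
    x % n + (x / n * n + n)       ≡⟨ cong₂ _+_ e (+-comm _ n) ⟩
    y % n + (suc (x / n) * n)     ≤⟨ +-monoʳ-≤ (y % n) (*-monoˡ-≤ n q) ⟩
    y % n + y / n * n             ≡⟨ m≡m%n+[m/n]*n y n ⟨
    y                             ∎))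
    where open ≤-Reasoning

  -- Enumeration of the cells along broken diagonals

  row col : ℕ → ℕ
  row p = p % n
  col p = (p + p / n) % n

  -- This is `j - i` modulo `n`, with `n ∸ toℕ i` standing for `- i`. It is the quotient by `n` of
  -- the position of the cell.
  diagonal : Fin n → Fin n → ℕ
  diagonal i j = (toℕ j + (n ∸ toℕ i)) % n

  position : Fin n → Fin n → ℕ
  position i j = toℕ i + diagonal i j * n

  row-position : ∀ i j → row (position i j) ≡ toℕ i
  row-position i j = trans ([m+kn]%n≡m%n (toℕ i) (diagonal i j) n) (m<n⇒m%n≡m (toℕ<n i))

  position/n : ∀ i j → position i j / n ≡ diagonal i j
  position/n i j = begin
    position i j / n                            ≡⟨ +-distrib-/-∣ʳ (toℕ i) (divides (diagonal i j) refl) ⟩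
    toℕ i / n + diagonal i j * n / n            ≡⟨ cong₂ _+_ (m<n⇒m/n≡0 (toℕ<n i)) (m*n/n≡m (diagonal i j) n) ⟩
    diagonal i j                                ∎
    where open ≡-Reasoning

  -- Modulo `n` the multiple `d * n` vanishes, and what remains is `i + (j - i)`.
  col-position : ∀ i j → col (position i j) ≡ toℕ j
  col-position i j = begin
    (a + d * n + position i j / n) % n   ≡⟨ cong (λ x → (a + d * n + x) % n) (position/n i j) ⟩
    (a + d * n + d) % n                  ≡⟨ cong (_% n) (xy∙z≈xz∙y a (d * n) d) ⟩
    (a + d + d * n) % n                  ≡⟨ [m+kn]%n≡m%n (a + d) d n ⟩
    (a + d) % n                          ≡⟨ cong (_% n) (+-comm a d) ⟩
    (d + a) % n                          ≡⟨ [m%n+o]%n≡[m+o]%n (b + (n ∸ a)) a ⟩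
    (b + (n ∸ a) + a) % n                ≡⟨ cong (_% n) (trans (+-assoc b _ a) (cong (b +_) (m∸n+n≡m (toℕ≤n i)))) ⟩
    (b + n) % n                          ≡⟨ [m+n]%n≡m%n b n ⟩
    b % n                                ≡⟨ m<n⇒m%n≡m (toℕ<n j) ⟩
    b                                    ∎
    where
    open ≡-Reasoning
    a = toℕ i
    b = toℕ j
    d = diagonal i j

  position< : ∀ i j → position i j < n * n
  position< i j = begin-strict
    toℕ i + diagonal i j * n  <⟨ +-monoˡ-< _ (toℕ<n i) ⟩
    suc (diagonal i j) * n    ≤⟨ *-monoˡ-≤ n (m%n<n _ n) ⟩
    n * n                     ∎
    where open ≤-Reasoning

  -- The preimage of `p` is the cell in row `row p` and column `col p`; subtracting the row from the
  -- column modulo `n` returns the quotient `p / n`.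
  position-surjective : ∀ {p} → p < n * n → ∃[ i ] ∃[ j ] position i j ≡ p
  position-surjective {p} p<n² = i , j , (begin
    toℕ i + (toℕ j + (n ∸ toℕ i)) % n * n
      ≡⟨ cong₂ (λ a b → a + (b + (n ∸ a)) % n * n) (toℕ-fromℕ< _) (toℕ-fromℕ< _) ⟩
    r + ((p + q) % n + (n ∸ r)) % n * n       ≡⟨ cong (λ x → r + x * n) col-row⇒quotient ⟩
    r + q * n                                 ≡⟨ m≡m%n+[m/n]*n p n ⟨
    p                                         ∎)
    where
    open ≡-Reasoning
    r = p % n
    q = p / n
    i = p mod n
    j = (p + q) mod n
    col-row⇒quotient : ((p + q) % n + (n ∸ r)) % n ≡ q
    col-row⇒quotient = begin
      ((p + q) % n + (n ∸ r)) % n     ≡⟨ [m%n+o]%n≡[m+o]%n (p + q) (n ∸ r) ⟩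
      (p + q + (n ∸ r)) % n           ≡⟨ cong (_% n) (xy∙z≈xz∙y p q _) ⟩
      (p + (n ∸ r) + q) % n           ≡⟨ cong (λ x → (x + (n ∸ r) + q) % n) (trans (m≡m%n+[m/n]*n p n) (+-comm r _)) ⟩
      (q * n + r + (n ∸ r) + q) % n   ≡⟨ cong (λ x → (x + q) % n) (trans (+-assoc (q * n) r _) (cong (q * n +_) (m+[n∸m]≡n (m%n≤n p n)))) ⟩
      (q * n + n + q) % n             ≡⟨ cong (_% n) (trans (+-comm _ q) (cong (q +_) (+-comm _ n))) ⟩
      (q + suc q * n) % n             ≡⟨ [m+kn]%n≡m%n q (suc q) n ⟩
      -- The bound `p < n * n` makes the quotient smaller than `n`, so it is its own residue.
      q % n                           ≡⟨ m<n⇒m%n≡m (m<n*o⇒m/o<n p<n²) ⟩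
      q                               ∎

  -- `row` and `col` recover the cell from its position.
  position-injective : ∀ {i j i′ j′} → position i j ≡ position i′ j′ → i ≡ i′ × j ≡ j′
  position-injective {i} {j} {i′} {j′} e =
    toℕ-injective (trans (sym (row-position i j)) (trans (cong row e) (row-position i′ j′))) ,
    toℕ-injective (trans (sym (col-position i j)) (trans (cong col e) (col-position i′ j′)))

  -- Distinct rows and columns within a block

  module _ {k : ℕ} {ρ : Vector ℕ k} (ρ≤n : ∀ ℓ → ρ ℓ ≤ n) (T : Layout n ρ) where
    open Layout T

    Block-close : ∀ ℓ {p p′} → Block ℓ p → Block ℓ p′ → p′ < p + ρ ℓ
    Block-close ℓ (l , _) (_ , u) = <-≤-trans u (+-monoˡ-≤ (ρ ℓ) l)

    Block-row-injective : ∀ ℓ {p p′} → Block ℓ p → Block ℓ p′ → row p ≡ row p′ → p ≡ p′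
    Block-row-injective ℓ {p} {p′} b b′ e with ≤-total p p′
    ... | inj₁ p≤p′ = %-≡-close p≤p′ (<-≤-trans (Block-close ℓ b b′) (+-monoʳ-≤ p (ρ≤n ℓ))) e
    ... | inj₂ p′≤p = sym (%-≡-close p′≤p (<-≤-trans (Block-close ℓ b′ b) (+-monoʳ-≤ p′ (ρ≤n ℓ))) (sym e))

    -- Columns are residues of `p + p / n`, so this sum must vary by less than `n` on a block. On a
    -- full block the quotient is constant. On a short block it grows by at most one, and `p` by at
    -- most `n - 2`.
    Block-spread : ∀ ℓ {p p′} → Block ℓ p → Block ℓ p′ → p′ + p′ / n < p + p / n + n
    Block-spread ℓ {p} {p′} b b′ with ρ ℓ ≟ n
    ... | yes full with divides c s≡cn ← aligned ℓ full = begin-strict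
      p′ + p′ / n     ≤⟨ +-monoʳ-≤ p′ (≤-trans p′/n≤c c≤p/n) ⟩
      p′ + p / n      <⟨ +-monoˡ-< (p / n) (subst (λ x → p′ < p + x) full (Block-close ℓ b b′)) ⟩
      p + n + p / n   ≡⟨ xy∙z≈xz∙y p n (p / n) ⟩
      p + p / n + n   ∎
      where
      open ≤-Reasoning
      c≤p/n : c ≤ p / n
      c≤p/n = subst (_≤ p / n) (m*n/n≡m c n) (/-monoˡ-≤ n (subst (_≤ p) s≡cn (proj₁ b)))
      -- An aligned full block ends just before `suc c * n`.
      p′/n≤c : p′ / n ≤ c
      p′/n≤c = ≤-pred (m<n*o⇒m/o<n {n = suc c} (subst (p′ <_) (trans (cong₂ _+_ s≡cn full) (+-comm _ n)) (proj₂ b′)))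
    ... | no ρ≢n = begin-strict
      p′ + p′ / n         ≤⟨ +-monoʳ-≤ p′ p′/n≤1+p/n ⟩
      p′ + suc (p / n)    ≡⟨ +-suc p′ _ ⟩
      -- The strict inequality of `Block-close` absorbs the extra one from the quotient; `ρ<n` makes
      -- the chain strict again.
      suc p′ + p / n      ≤⟨ +-monoˡ-≤ (p / n) (Block-close ℓ b b′) ⟩
      p + ρ ℓ + p / n     <⟨ +-monoˡ-< (p / n) (+-monoʳ-< p ρ<n) ⟩
      p + n + p / n       ≡⟨ xy∙z≈xz∙y p n (p / n) ⟩
      p + p / n + n       ∎
      where
      open ≤-Reasoning
      ρ<n : ρ ℓ < n
      ρ<n = ≤∧≢⇒< (ρ≤n ℓ) ρ≢n
      p′/n≤1+p/n : p′ / n ≤ suc (p / n)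
      p′/n≤1+p/n = begin
        p′ / n        ≤⟨ /-monoˡ-≤ n (<⇒≤ (<-trans (Block-close ℓ b b′) (+-monoʳ-< p ρ<n))) ⟩
        (p + n) / n   ≡⟨ +-distrib-/-∣ʳ p (∣-reflexive refl) ⟩
        p / n + n / n ≡⟨ cong (p / n +_) (n/n≡1 n) ⟩
        p / n + 1     ≡⟨ +-comm (p / n) 1 ⟩
        suc (p / n)   ∎

    -- The sum `p + p / n` is strictly increasing, so `p < p′` would give two different sums less
    -- than `n` apart with the same residue.
    Block-col-injective-≤ : ∀ ℓ {p p′} → Block ℓ p → Block ℓ p′ → p ≤ p′ → col p ≡ col p′ → p ≡ p′
    Block-col-injective-≤ ℓ {p} {p′} b b′ p≤p′ e with m≤n⇒m<n∨m≡n p≤p′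
    ... | inj₂ p≡p′ = p≡p′
    ... | inj₁ p<p′ = ⊥-elim (<⇒≢ sum< (%-≡-close (<⇒≤ sum<) (Block-spread ℓ b b′) e))
      where
      sum< : p + p / n < p′ + p′ / n
      sum< = +-mono-<-≤ p<p′ (/-monoˡ-≤ n p≤p′)

    Block-col-injective : ∀ ℓ {p p′} → Block ℓ p → Block ℓ p′ → col p ≡ col p′ → p ≡ p′
    Block-col-injective ℓ {p} {p′} b b′ e with ≤-total p p′
    ... | inj₁ p≤p′ = Block-col-injective-≤ ℓ b b′ p≤p′ e
    ... | inj₂ p′≤p = sym (Block-col-injective-≤ ℓ b′ b p′≤p (sym e))

    -- The square and its symbol counts

    module _ (Σρ≡n² : sum ρ ≡ n * n) where

      block-of : ∀ i j → ∃[ ℓ ] Block ℓ (position i j)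
      block-of i j = cover (subst (position i j <_) (sym Σρ≡n²) (position< i j))

      square : Array n k
      square i j = proj₁ (block-of i j)

      -- Taking the symbol through an equation lets two cells with equal symbols be placed in one
      -- common block.
      square-Block : ∀ {ℓ} i j → square i j ≡ ℓ → Block ℓ (position i j)
      square-Block i j refl = proj₂ (block-of i j)

      -- `position` maps the cells with symbol `ℓ` injectively onto the block of `ℓ`, an interval
      -- with `ρ ℓ` elements.
      occurrences-square : ∀ ℓ → occurrences square ℓ ≡ ρ ℓ
      occurrences-square ℓ = begin
        length cells                             ≡⟨ length-map (uncurry position) cells ⟨
        length (map (uncurry position) cells)    ≡⟨ length-cong-set positions! block! (mk⇔ to from) ⟩
        length (applyUpTo (start ℓ +_) (ρ ℓ))    ≡⟨ length-applyUpTo (start ℓ +_) (ρ ℓ) ⟩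
        ρ ℓ                                      ∎
        where
        open ≡-Reasoning

        hasSymbol? = λ (i , j) → square i j Fin.≟ ℓ

        cells : List (Fin n × Fin n)
        cells = filter hasSymbol? (cartesianProduct (allFin n) (allFin n))

        positions! : Unique (map (uncurry position) cells)
        positions! = Unique.map⁺ (uncurry (cong₂ _,_) ∘ position-injective)
          (Unique.filter⁺ hasSymbol? (Unique.cartesianProduct⁺ (Unique.allFin⁺ n) (Unique.allFin⁺ n)))

        block! : Unique (applyUpTo (start ℓ +_) (ρ ℓ))
        block! = Unique.applyUpTo⁺₁ _ (ρ ℓ) λ x<y _ → <⇒≢ (+-monoʳ-< (start ℓ) x<y)

        to : ∀ {p} → p ∈ map (uncurry position) cells → p ∈ applyUpTo (start ℓ +_) (ρ ℓ)
        to p∈ with (i , j) , c∈ , refl ← ∈-map⁻ (uncurry position) p∈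
              with l , u ← square-Block i j (proj₂ (∈-filter⁻ hasSymbol? {xs = cartesianProduct (allFin n) (allFin n)} c∈))
              with x , e ← m≤n⇒∃[o]m+o≡n l
          = subst (_∈ applyUpTo (start ℓ +_) (ρ ℓ)) e
              (∈-applyUpTo⁺ (start ℓ +_) (+-cancelˡ-< (start ℓ) _ _ (subst (_< start ℓ + ρ ℓ) (sym e) u)))

        from : ∀ {p} → p ∈ applyUpTo (start ℓ +_) (ρ ℓ) → p ∈ map (uncurry position) cells
        from p∈ with x , x<ρ , refl ← ∈-applyUpTo⁻ (start ℓ +_) p∈
          with u ← +-monoʳ-< (start ℓ) x<ρ
          with i , j , e ← position-surjective (subst (start ℓ + x <_) Σρ≡n² (<-≤-trans u (bounded ℓ)))
          = subst (_∈ map (uncurry position) cells) e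
              (∈-map⁺ (uncurry position)
                (∈-filter⁺ hasSymbol? (∈-cartesianProduct⁺ (∈-allFin i) (∈-allFin j))
                  -- The symbol of this cell is whichever one `cover` returned; disjointness of the
                  -- blocks forces it to be `ℓ`.
                  (disjoint (proj₂ (block-of i j)) (subst (Block ℓ) (sym e) (m≤m+n _ x , u)))))

      -- Equal symbols in one line mean two positions in one block with the same row or column. They
      -- coincide, and a position determines its cell.
      square-isLatin : IsLatinSquare ρ square
      square-isLatin = record
        { row-injective    = λ i {j} {j′} e → proj₂ (position-injective {i} {j} {i} {j′}
            (Block-row-injective _ (square-Block i j e) (square-Block i j′ refl)
              (trans (row-position i j) (sym (row-position i j′)))))
        ; column-injective = λ j {i} {i′} e → proj₁ (position-injective {i} {j} {i′} {j}
            (Block-col-injective _ (square-Block i j e) (square-Block i′ j refl)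
              (trans (col-position i j) (sym (col-position i′ j)))))
        ; occurs-ρ         = occurrences-square
        }

theorem2p2 : (n k : ℕ) → 1 ≤ n → 1 ≤ k → (ρ : Vector ℕ k) →
    (∀ ℓ → 1 ≤ ρ ℓ) → (∀ ℓ → ρ ℓ ≤ n) → n ≤ k →
    sum ρ ≡ n ^ 2 →
    ∃[ L ] IsLatinSquare {n} {k} ρ L
theorem2p2 n k 1≤n _ ρ _ ρ≤n _ Σρ≡n^2 =
  square ρ≤n (layout n ρ) Σρ≡n² ,
  square-isLatin ρ≤n (layout n ρ) Σρ≡n²
  where
  instance
    n≢0 : NonZero n
    n≢0 = >-nonZero 1≤n
  Σρ≡n² : sum ρ ≡ n * n
  -- `n ^ 2` unfolds to `n * (n * 1)`.
  Σρ≡n² = trans Σρ≡n^2 (cong (n *_) (*-identityʳ n))
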